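{- Let $1\le P\le N$ and $1\le Q\le M$ be integers. Let $UC$ be the set of unique combinations, and for each $(\Delta r,\Delta c)\in UC$ let $W(\Delta r,\Delta c)$ be its set of target indices in the $PQ\times PQ$ output matrix. Then the sets $W(\Delta r,\Delta c)$, $(\Delta r,\Delta c)\in UC$, jointly cover the entire upper triangle: every index $(a,b)$ with $1\le a\le b\le PQ$ belongs to $W(\Delta r,\Delta c)$ for some $(\Delta r,\Delta c)\in UC$. Moreover, any given index of the output matrix is written to by a single combination: no index belongs to $W(\Delta r,\Delta c)$ for two different elements $(\Delta r,\Delta c)\in UC$.
   Context: All indices start at 1. The input matrix $A$ has size $N\times M$. For $1\le p\le N-P+1$, $1\le q\le M-Q+1$, the window $S^{p,q}$ is the $P\times Q$ block of $A$ with upper left corner at position $(p,q)$, so $S^{p,q}(i,j)=A_{p+i-1,\,q+j-1}$ for $1\le i\le P$, $1\le j\le Q$. Its column stack is the vector $\vec V^{p,q}$ of length $PQ$ with $\vec V^{p,q}(P(j-1)+i)=S^{p,q}(i,j)$. The output matrix $C$ (size $PQ\times PQ$) is the sum over the window positions of $\vec V^{p,q}(\vec V^{p,q})^H$. The inter-element distance of an ordered pair of positions $((r_1,c_1),(r_2,c_2))$ of $A$ is $(r_2-r_1,\,c_2-c_1)$. A combination is the set of all products $A_{r_1,c_1}\overline{A_{r_2,c_2}}$ over ordered pairs of positions with a given inter-element distance $(\Delta r,\Delta c)$, where $-(P-1)\le\Delta r\le P-1$ and $-(Q-1)\le\Delta c\le Q-1$; products are treated formally, i.e. identified by the pair of positions,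 and the combination is denoted by $(\Delta r,\Delta c)$. The set of unique combinations is $$UC=\{(\Delta r,\Delta c): 0\le\Delta r\le P-1,\ 0\le\Delta c\le Q-1\}\cup\{(\Delta r,\Delta c): -(P-1)\le\Delta r\le -1,\ 1\le\Delta c\le Q-1\}.$$ Target (write) indices: if a window $S^{p,q}$ contains both positions $(r_1,c_1)$ and $(r_2,c_2)$, with coordinates $(i_1,j_1)=(r_1-p+1,\,c_1-q+1)$ and $(i_2,j_2)=(r_2-p+1,\,c_2-q+1)$ within the window, then the product $A_{r_1,c_1}\overline{A_{r_2,c_2}}$ is written, in the context of that window, to the output index $(P(j_1-1)+i_1,\ P(j_2-1)+i_2)$. The set $W(\Delta r,\Delta c)$ of target indices of a combination is the set of all output indices to which some product in the combination is written in the context of some window containing its two positions. The upper triangle of the output matrix is the set of indices $(a,b)$ with $1\le a\le b\le PQ$ (main diagonal included). -}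

module Defs where

open import Data.Nat using (ℕ; _+_; _*_; _∸_; _≤_; _<_)
open import Data.Integer as ℤ using (ℤ; +_; 0ℤ; 1ℤ)
open import Data.Product using (_×_; _,_; ∃-syntax)
open import Level using (0ℓ)
open import Relation.Binary.PropositionalEquality using (_≡_)
open import Relation.Unary using (Pred; _∈_; _∪_)

-- All indices are 1-based natural numbers; pairs are (row , column).

Position : Set
Position = ℕ × ℕ

Index : Set
Index = ℕ × ℕ

Distance : Set
Distance = ℤ × ℤ

-- A formal product A_x · conj(A_y) is identified with the ordered pair (x , y).
Product : Set
Product = Position × Position

InMatrix : (N M : ℕ) → Pred Position 0ℓ
InMatrix N M (r , c) = (1 ≤ r × r ≤ N) × (1 ≤ c × c ≤ M)

distance : Product → Distance
distance ((r₁ , c₁) , (r₂ , c₂)) = (+ r₂ ℤ.- + r₁) , (+ c₂ ℤ.- + c₁)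

-- Defined for every distance; the bounds |Δr| ≤ P-1, |Δc| ≤ Q-1 imposed on
-- combinations hold for each element of UC P Q.
Combination : (N M : ℕ) → Distance → Pred Product 0ℓ
Combination N M Δ (x , y) =
  x ∈ InMatrix N M × y ∈ InMatrix N M × distance (x , y) ≡ Δ

-- Upper left corners (p , q) of windows.  The truncated subtractions are exact
-- when P ≤ N and Q ≤ M.
Corner : (N M P Q : ℕ) → Pred Position 0ℓ
Corner N M P Q (p , q) =
  (1 ≤ p × p ≤ (N ∸ P) + 1) × (1 ≤ q × q ≤ (M ∸ Q) + 1)

Window : (P Q : ℕ) → Position → Pred Position 0ℓ
Window P Q (p , q) (r , c) = (p ≤ r × r < p + P) × (q ≤ c × c < q + Q)

-- The truncated subtraction is exact when the position lies in the window.
coordinates : (corner : Position) → Position → ℕ × ℕ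
coordinates (p , q) (r , c) = ((r ∸ p) + 1) , ((c ∸ q) + 1)

-- Place of the window entry (i , j) in the column stack.
stack : (P : ℕ) → ℕ × ℕ → ℕ
stack P (i , j) = P * (j ∸ 1) + i

target : (P : ℕ) → (corner : Position) → Product → Index
target P w (x , y) = stack P (coordinates w x) , stack P (coordinates w y)

W : (N M P Q : ℕ) → Distance → Pred Index 0ℓ
W N M P Q Δ ab =
  ∃[ x ] ∃[ y ] ∃[ w ]
    ( (x , y) ∈ Combination N M Δ
    × w ∈ Corner N M P Q
    × x ∈ Window P Q w
    × y ∈ Window P Q w
    × ab ≡ target P w (x , y) )

UC : (P Q : ℕ) → Pred Distance 0ℓ
UC P Q = nonNegativeRow ∪ negativeRow
  where
  nonNegativeRow negativeRow : Pred Distance 0ℓ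
  nonNegativeRow (Δr , Δc) =
      (0ℤ ℤ.≤ Δr × Δr ℤ.≤ + P ℤ.- 1ℤ)
    × (0ℤ ℤ.≤ Δc × Δc ℤ.≤ + Q ℤ.- 1ℤ)
  negativeRow (Δr , Δc) =
      (ℤ.- (+ P ℤ.- 1ℤ) ℤ.≤ Δr × Δr ℤ.≤ ℤ.- 1ℤ)
    × (1ℤ ℤ.≤ Δc × Δc ℤ.≤ + Q ℤ.- 1ℤ)

UpperTriangle : (P Q : ℕ) → Pred Index 0ℓ
UpperTriangle P Q (a , b) = 1 ≤ a × a ≤ b × b ≤ P * Q

-- An entry is determined, relative to its window, by its zero-based offsets (u , v) with
-- u < P, and the column stack places it at 1 + (u + v P).  Euclidean division by P recovers
-- (u , v), so a target index determines the offsets of both factors, hence their distance.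
-- Conversely the offsets of a ≤ b, read in the window at (1 , 1), satisfy v₁ ≤ v₂, and
-- v₁ < v₂ whenever u₂ < u₁; this is exactly membership of the distance in UC.

{-# OPTIONS --safe #-}
module Submission where

open import Defs
open import Data.Nat using (ℕ; suc; _+_; _*_; _∸_; _≤_; _<_; z≤n; s≤s; NonZero; _/_; _%_)
open import Data.Nat.DivMod using (m≡m%n+[m/n]*n; m%n<n; [m+kn]%n≡m%n; m<n⇒m%n≡m; /-monoˡ-≤; m<n*o⇒m/o<n)
open import Data.Nat.Properties
open import Data.Integer as ℤ using (+_; -_; _⊖_; 0ℤ; 1ℤ; +≤+)
import Data.Integer.Properties as ℤ
open import Data.Product using (_×_; _,_; ∃-syntax; proj₁; proj₂)
open import Data.Sum using (_⊎_; inj₁; inj₂)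
open import Relation.Binary.PropositionalEquality
  using (_≡_; refl; sym; trans; cong; cong₂; subst; module ≡-Reasoning)
open import Relation.Nullary using (contradiction)
open import Relation.Unary using (_∈_)

-- With the 1 pulled out as `suc`, what remains has the shape `u + v * P` that Euclidean division by
-- `P` inverts.
stack-coordinates : ∀ P p q r c →
  stack P (coordinates (p , q) (r , c)) ≡ suc ((r ∸ p) + (c ∸ q) * P)
stack-coordinates P p q r c = begin
  P * ((c ∸ q) + 1 ∸ 1) + ((r ∸ p) + 1)  ≡⟨ cong (λ v → P * v + ((r ∸ p) + 1)) (m+n∸n≡m (c ∸ q) 1) ⟩
  P * (c ∸ q) + ((r ∸ p) + 1)            ≡⟨ cong₂ _+_ (*-comm P (c ∸ q)) (+-comm (r ∸ p) 1) ⟩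
  (c ∸ q) * P + suc (r ∸ p)              ≡⟨ +-comm ((c ∸ q) * P) (suc (r ∸ p)) ⟩
  suc ((r ∸ p) + (c ∸ q) * P)            ∎
  where open ≡-Reasoning

remainder-quotient-unique : ∀ n .{{_ : NonZero n}} {u u′} v v′ → u < n → u′ < n →
  u + v * n ≡ u′ + v′ * n → u ≡ u′ × v ≡ v′
remainder-quotient-unique n {u} {u′} v v′ u<n u′<n eq = u≡u′ , v≡v′
  where
  open ≡-Reasoning
  u≡u′ : u ≡ u′
  u≡u′ = begin
    u                   ≡⟨ m<n⇒m%n≡m u<n ⟨
    u % n               ≡⟨ [m+kn]%n≡m%n u v n ⟨
    (u + v * n) % n     ≡⟨ cong (_% n) eq ⟩
    (u′ + v′ * n) % n   ≡⟨ [m+kn]%n≡m%n u′ v′ n ⟩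
    u′ % n              ≡⟨ m<n⇒m%n≡m u′<n ⟩
    u′                  ∎
  v≡v′ : v ≡ v′
  v≡v′ = *-cancelʳ-≡ v v′ n
    (+-cancelˡ-≡ u _ _ (trans eq (cong (_+ v′ * n) (sym u≡u′))))

<+⇒∸< : ∀ {p r P} → p ≤ r → r < p + P → r ∸ p < P
<+⇒∸< {p} {r} {P} p≤r r<p+P =
  +-cancelˡ-< p (r ∸ p) P (subst (_< p + P) (sym (m+[n∸m]≡n p≤r)) r<p+P)

-- Membership in a window keeps the row offset below `P`, so it is a genuine remainder, with the
-- column offset as quotient. The two corners may differ.
stack-coordinates-injective : ∀ P .{{_ : NonZero P}} Q Q′ p q p′ q′ r c r′ c′ →
  (r , c) ∈ Window P Q (p , q) → (r′ , c′) ∈ Window P Q′ (p′ , q′) →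
  stack P (coordinates (p , q) (r , c)) ≡ stack P (coordinates (p′ , q′) (r′ , c′)) →
  r ∸ p ≡ r′ ∸ p′ × c ∸ q ≡ c′ ∸ q′
stack-coordinates-injective P Q Q′ p q p′ q′ r c r′ c′ ((p≤r , r<) , _) ((p′≤r′ , r′<) , _) eq =
  remainder-quotient-unique P (c ∸ q) (c′ ∸ q′) (<+⇒∸< p≤r r<) (<+⇒∸< p′≤r′ r′<)
    (suc-injective (trans (sym (stack-coordinates P p q r c))
                          (trans eq (stack-coordinates P p′ q′ r′ c′))))

-- The corner cancels from the difference, so products read in different windows can be compared
-- through their offsets alone.
difference-offset : ∀ {p r₁ r₂} → p ≤ r₁ → p ≤ r₂ → + r₂ ℤ.- + r₁ ≡ (r₂ ∸ p) ⊖ (r₁ ∸ p)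
difference-offset {p} {r₁} {r₂} p≤r₁ p≤r₂ = begin
  + r₂ ℤ.- + r₁                       ≡⟨ ℤ.m-n≡m⊖n r₂ r₁ ⟩
  r₂ ⊖ r₁                             ≡⟨ cong₂ _⊖_ (m+[n∸m]≡n p≤r₂) (m+[n∸m]≡n p≤r₁) ⟨
  (p + (r₂ ∸ p)) ⊖ (p + (r₁ ∸ p))     ≡⟨ ℤ.+-cancelˡ-⊖ p (r₂ ∸ p) (r₁ ∸ p) ⟩
  (r₂ ∸ p) ⊖ (r₁ ∸ p)                 ∎
  where open ≡-Reasoning

W-unique : ∀ N M P .{{_ : NonZero P}} Q ab Δ Δ′ →
  ab ∈ W N M P Q Δ → ab ∈ W N M P Q Δ′ → Δ ≡ Δ′
W-unique N M P Q ab Δ Δ′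
  ((r₁ , c₁) , (r₂ , c₂) , (p , q) , (_ , _ , refl) , _
    , x∈w@((p≤r₁ , _) , (q≤c₁ , _)) , y∈w@((p≤r₂ , _) , (q≤c₂ , _)) , ab≡)
  ((r₁′ , c₁′) , (r₂′ , c₂′) , (p′ , q′) , (_ , _ , refl) , _
    , x′∈w′@((p′≤r₁′ , _) , (q′≤c₁′ , _)) , y′∈w′@((p′≤r₂′ , _) , (q′≤c₂′ , _)) , ab≡′)
  = cong₂ _,_
      (trans (difference-offset p≤r₁ p≤r₂)
        (trans (cong₂ _⊖_ (proj₁ y≡) (proj₁ x≡)) (sym (difference-offset p′≤r₁′ p′≤r₂′))))
      (trans (difference-offset q≤c₁ q≤c₂)
        (trans (cong₂ _⊖_ (proj₂ y≡) (proj₂ x≡)) (sym (difference-offset q′≤c₁′ q′≤c₂′))))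
  where
  target≡ = trans (sym ab≡) ab≡′
  x≡ = stack-coordinates-injective P Q Q p q p′ q′ r₁ c₁ r₁′ c₁′ x∈w x′∈w′ (cong proj₁ target≡)
  y≡ = stack-coordinates-injective P Q Q p q p′ q′ r₂ c₂ r₂′ c₂′ y∈w y′∈w′ (cong proj₂ target≡)

⊖≤pred : ∀ {n P} m → n < P → n ⊖ m ℤ.≤ + P ℤ.- 1ℤ
-- Once `P` is a successor, `+ P ℤ.- 1ℤ` computes to its predecessor, which bounds `n` and hence
-- `n ⊖ m`.
⊖≤pred {n} {suc _} m (s≤s n≤P) = ℤ.≤-trans (ℤ.m⊖n≤m n m) (+≤+ n≤P)

0≤⊖ : ∀ {m n} → m ≤ n → 0ℤ ℤ.≤ n ⊖ m
0≤⊖ m≤n = subst (0ℤ ℤ.≤_) (sym (ℤ.⊖-≥ m≤n)) (+≤+ z≤n)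

1≤⊖ : ∀ {m n} → m < n → 1ℤ ℤ.≤ n ⊖ m
1≤⊖ m<n = subst (1ℤ ℤ.≤_) (sym (ℤ.⊖-≥ (<⇒≤ m<n))) (+≤+ (m<n⇒0<n∸m m<n))

-- The two alternatives of the last hypothesis correspond to the two parts of `UC`.
offset-distance-in-UC : ∀ {P Q u₁ v₁ u₂ v₂} → u₁ < P → u₂ < P → v₂ < Q →
  v₁ ≤ v₂ → u₁ ≤ u₂ ⊎ (u₂ < u₁ × v₁ < v₂) → (u₂ ⊖ u₁ , v₂ ⊖ v₁) ∈ UC P Q
offset-distance-in-UC {u₁ = u₁} {v₁} _ u₂<P v₂<Q v₁≤v₂ (inj₁ u₁≤u₂) =
  inj₁ ((0≤⊖ u₁≤u₂ , ⊖≤pred u₁ u₂<P) , (0≤⊖ v₁≤v₂ , ⊖≤pred v₁ v₂<Q))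
offset-distance-in-UC {P} {u₁ = u₁} {v₁} {u₂} u₁<P _ v₂<Q _ (inj₂ (u₂<u₁ , v₁<v₂)) =
  -- Both row bounds come from negating those of the positive difference `u₁ ⊖ u₂`.
  inj₂ (( subst (- (+ P ℤ.- 1ℤ) ℤ.≤_) swap (ℤ.neg-mono-≤ (⊖≤pred u₂ u₁<P))
        , subst (ℤ._≤ - 1ℤ) swap (ℤ.neg-mono-≤ (1≤⊖ u₂<u₁)))
       , (1≤⊖ v₁<v₂ , ⊖≤pred v₁ v₂<Q))
  where
  swap : - (u₁ ⊖ u₂) ≡ u₂ ⊖ u₁
  swap = sym (ℤ.⊖-swap u₂ u₁)

remainder-≤-or-quotient-< : ∀ n .{{_ : NonZero n}} {a b} → a ≤ b →
  a % n ≤ b % n ⊎ (b % n < a % n × a / n < b / n)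
remainder-≤-or-quotient-< n {a} {b} a≤b with ≤-<-connex (a % n) (b % n)
... | inj₁ a%≤b% = inj₁ a%≤b%
-- If the quotients agreed, the smaller remainder of `b` would force `b < a`.
... | inj₂ b%<a% = inj₂ (b%<a% , ≤∧≢⇒< (/-monoˡ-≤ n a≤b) λ a/≡b/ →
  contradiction (begin-strict
    b                    ≡⟨ m≡m%n+[m/n]*n b n ⟩
    b % n + b / n * n    <⟨ +-monoˡ-< (b / n * n) b%<a% ⟩
    a % n + b / n * n    ≡⟨ cong (λ k → a % n + k * n) a/≡b/ ⟨
    a % n + a / n * n    ≡⟨ m≡m%n+[m/n]*n a n ⟨
    a                    ∎) (≤⇒≯ a≤b))
  where open ≤-Reasoning

UC-covers : ∀ {N M} P .{{_ : NonZero P}} {Q} → P ≤ N → Q ≤ M →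
  ∀ ab → ab ∈ UpperTriangle P Q → ∃[ Δ ] (Δ ∈ UC P Q × ab ∈ W N M P Q Δ)
UC-covers {N} {M} P {Q} P≤N Q≤M (suc a , suc b) (_ , s≤s a≤b , b<PQ) =
  -- Here `a` and `b` are already zero-based, the pattern having removed the `suc`; remainders are
  -- row offsets and quotients column offsets.
  ((b % P) ⊖ (a % P) , (b / P) ⊖ (a / P)) ,
  offset-distance-in-UC (m%n<n a P) (m%n<n b P) (quotient<Q b<PQ) (/-monoˡ-≤ P a≤b)
    (remainder-≤-or-quotient-< P a≤b) ,
  entry a , entry b , (1 , 1) ,
  ( inMatrix a<PQ , inMatrix b<PQ
  , cong₂ _,_ (ℤ.[1+m]⊖[1+n]≡m⊖n (b % P) (a % P)) (ℤ.[1+m]⊖[1+n]≡m⊖n (b / P) (a / P))) ,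
  ((≤-refl , m≤n+m 1 (N ∸ P)) , (≤-refl , m≤n+m 1 (M ∸ Q))) ,
  inWindow a<PQ , inWindow b<PQ , cong₂ _,_ (entry-stack a) (entry-stack b)
  where
  a<PQ : a < P * Q
  a<PQ = ≤-<-trans a≤b b<PQ

  quotient<Q : ∀ {k} → k < P * Q → k / P < Q
  quotient<Q {k} k<PQ = m<n*o⇒m/o<n (subst (k <_) (*-comm P Q) k<PQ)

  entry : ℕ → Position
  entry k = suc (k % P) , suc (k / P)

  inWindow : ∀ {k} → k < P * Q → entry k ∈ Window P Q (1 , 1)
  inWindow {k} k<PQ = (s≤s z≤n , s≤s (m%n<n k P)) , (s≤s z≤n , s≤s (quotient<Q k<PQ))

  inMatrix : ∀ {k} → k < P * Q → entry k ∈ InMatrix N M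
  inMatrix {k} k<PQ =
    (s≤s z≤n , ≤-trans (m%n<n k P) P≤N) , (s≤s z≤n , ≤-trans (quotient<Q k<PQ) Q≤M)

  entry-stack : ∀ k → suc k ≡ stack P (coordinates (1 , 1) (entry k))
  entry-stack k = trans (cong suc (m≡m%n+[m/n]*n k P))
    (sym (stack-coordinates P 1 1 (suc (k % P)) (suc (k / P))))

mainTheorem1 : (N M P Q : ℕ) → 1 ≤ P → P ≤ N → 1 ≤ Q → Q ≤ M →
    ((ab : Index) → ab ∈ UpperTriangle P Q →
    ∃[ Δ ] (Δ ∈ UC P Q × ab ∈ W N M P Q Δ))
    × ((ab : Index) (Δ Δ′ : Distance) → Δ ∈ UC P Q → Δ′ ∈ UC P Q →
    ab ∈ W N M P Q Δ → ab ∈ W N M P Q Δ′ → Δ ≡ Δ′)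
-- Matching on `suc _` provides the `NonZero P` instance for division; the case of zero is ruled out
-- by `1 ≤ P`.
mainTheorem1 N M P@(suc _) Q 1≤P P≤N 1≤Q Q≤M =
  UC-covers P P≤N Q≤M , λ ab Δ Δ′ _ _ → W-unique N M P Q ab Δ Δ′
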